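{- Let $\mathbb C=(A,\mathcal C)$ be a proto-precontact algebra and let $\overline{\mathcal C}=(A\times A)\setminus\mathcal C$. Let $\rhd a=\bigvee\{b\in A\mid a\,\overline{\mathcal C}\,b\}$ and $\blacktriangleright a=\bigvee\{b\in A\mid b\,\overline{\mathcal C}\,a\}$ (joins in $A^\delta$), extended to $A^\delta$ as $\rhd^\pi,\blacktriangleright^\pi$ (superscripts omitted). Inequalities are in $A^\delta$, with $a,b$ ranging over $A$. 1. If $\mathbb C$ is antitone, then (i) $\overline{\mathcal C}\subseteq\,\le$ iff $\rhd a\le a$ for all $a$. (ii) $\le\,\subseteq\overline{\mathcal C}$ iff $a\le\rhd a$ for all $a$. (iii) $\overline{\mathcal C}\subseteq\,\ge$ iff $\blacktriangleright a\le a$ for all $a$. (iv) $\ge\,\subseteq\overline{\mathcal C}$ iff $a\le\blacktriangleright a$ for all $a$. (v) (for $A$ bounded) (NS) holds iff $a\wedge\rhd a\le\bot$ for all $a$. (vi) (for $A$ a bounded join-semilattice) (SFN) holds iff $\top\le a\vee\rhd a$ for all $a$. 2. If $\mathbb C$ is a precontact algebra, then the conditions in each of the following lists are equivalent (inequalities being required for all $a\in A$): (i) $\overline{\mathcal C}^{ -1}\circ\overline{\mathcal C}\subseteq\overline{\mathcal C}$; $\rhd a\le\rhd\rhd a$; $\rhd a\le\blacktriangleright\rhd a$; $\overline{\mathcal C}^{ -1}\circ\overline{\mathcal C}\subseteq\overline{\mathcal C}^{ -1}$. (ii) $\overline{\mathcal C}^{ -1}\circ\overline{\mathcal C}\subseteq\overline{\mathcal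 C}$; $\blacktriangleright a\le\blacktriangleright\blacktriangleright a$; $\blacktriangleright a\le\rhd\blacktriangleright a$; $\overline{\mathcal C}^{ -1}\circ\overline{\mathcal C}\subseteq\overline{\mathcal C}^{ -1}$. (iii) $\overline{\mathcal C}\circ\overline{\mathcal C}\subseteq\overline{\mathcal C}$; $\blacktriangleright a\le\blacktriangleright\rhd a$; $\rhd a\le\rhd\blacktriangleright a$; $\overline{\mathcal C}^{ -1}\circ\overline{\mathcal C}^{ -1}\subseteq\overline{\mathcal C}^{ -1}$. (iv) $\overline{\mathcal C}\circ\overline{\mathcal C}\subseteq\overline{\mathcal C}^{ -1}$; $\rhd a\le\blacktriangleright\blacktriangleright a$; $\blacktriangleright a\le\rhd\rhd a$; $\overline{\mathcal C}^{ -1}\circ\overline{\mathcal C}^{ -1}\subseteq\overline{\mathcal C}$. 3. If $\mathbb C$ is a precontact algebra and $A$ is a lattice, the following are equivalent: $\overline{\mathcal C}\subseteq\overline{\mathcal C}^{ -1}$; $\overline{\mathcal C}^{ -1}\subseteq\overline{\mathcal C}$; $\rhd a\le\blacktriangleright a$ for all $a$; $a\le\rhd\rhd a$ for all $a$; $\blacktriangleright a\le\rhd a$ for all $a$; $a\le\blacktriangleright\blacktriangleright a$ for all $a$. 4. If $\mathbb C$ is a precontact algebra and $A$ is also a meet-semilattice, then (CMO) holds iff $\rhd a\le\rhd(a\wedge\rhd a)$ for all $a$. 5. If $\mathbb C$ is a precontact algebra and $A$ is a distributive lattice, then (i) (ALT)$^{\rhd}$ holds iff $\top\le\rhd a\vee\rhd\rhd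 a$ for all $a$; (ii) (ALT)$^{\blacktriangleright}$ holds iff $\top\le\blacktriangleright a\vee\blacktriangleright\blacktriangleright a$ for all $a$. 6. If $\mathbb C$ is a precontact algebra and $A$ is a Heyting algebra, then ($\vee\wedge$) holds iff $\rhd(a\vee b)\wedge(b\to\rhd a)\le a\to\blacktriangleright b$ for all $a,b$.
   Context: Canonical extension. For a poset $A$, $A^\delta$ is a complete lattice containing $A$ as a subposet. $k\in A^\delta$ is closed ($k\in K(A^\delta)$) if $k=\bigwedge F$ for some nonempty down-directed $F\subseteq A$; $o$ is open ($o\in O(A^\delta)$) if $o=\bigvee I$ for some nonempty up-directed $I\subseteq A$. Denseness: every element of $A^\delta$ is a join of closed elements and a meet of open elements. Compactness: if $F\subseteq A$ is nonempty down-directed, $I\subseteq A$ nonempty up-directed and $\bigwedge F\le\bigvee I$, then $a\le b$ for some $a\in F$, $b\in I$. $A^\delta$ exists and is unique up to isomorphism fixing $A$. A proto-precontact algebra is a pair $(A,\mathcal C)$ with $A$ a poset and $\mathcal C\subseteq A\times A$. Conditions (free variables universally quantified): (SB)$^\rhd$ $\exists b(b\,\overline{\mathcal C}\,a)$; (SF)$^\rhd$ $\exists b(a\,\overline{\mathcal C}\,b)$; (SI)$^\rhd$ $b\,\overline{\mathcal C}\,c\ \&\ a\le b\Rightarrow a\,\overline{\mathcal C}\,c$; (WO)$^\rhd$ $a\,\overline{\mathcal C}\,c\ \&\ b\le c\Rightarrow a\,\overline{\mathcal C}\,b$; (DD)$^\rhd$ $a\,\overline{\mathcal C}\,x_1\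 \&\ a\,\overline{\mathcal C}\,x_2\Rightarrow\exists x(x_1\le x\ \&\ x_2\le x\ \&\ a\,\overline{\mathcal C}\,x)$; (UD)$^\rhd$ $a_1\,\overline{\mathcal C}\,x\ \&\ a_2\,\overline{\mathcal C}\,x\Rightarrow\exists a(a_1\le a\ \&\ a_2\le a\ \&\ a\,\overline{\mathcal C}\,x)$. $\mathbb C$ is antitone if it satisfies these six conditions; then $\rhd a$ and $\blacktriangleright a$ are open for each $a\in A$. A precontact algebra is an antitone proto-precontact algebra with $A$ a bounded join-semilattice (bottom $\bot$, top $\top$) which moreover satisfies $\bot\,\overline{\mathcal C}\,\top$, $\top\,\overline{\mathcal C}\,\bot$, (AND)$^\rhd$ $a\,\overline{\mathcal C}\,b\ \&\ a\,\overline{\mathcal C}\,c\Rightarrow a\,\overline{\mathcal C}\,(b\vee c)$ and (OR)$^\rhd$ $a\,\overline{\mathcal C}\,c\ \&\ b\,\overline{\mathcal C}\,c\Rightarrow(a\vee b)\,\overline{\mathcal C}\,c$. Extensions: for $f\in\{\rhd,\blacktriangleright\}$, $f^\pi k=\bigvee\{f a\mid a\in A,k\le a\}$ for $k$ closed and $f^\pi u=\bigwedge\{f^\pi k\mid k\in K(A^\delta),k\le u\}$ for $u\in A^\delta$. In item 6, for $u,v\in A^\delta$, $u\to v$ is the largest $w\in A^\delta$ with $u\wedge w\le v$. Relational composition is read left to right: $x\,(R\circ S)\,y$ iff $x\,R\,z$ and $z\,S\,y$ for some $z$; $R^{ -1}$ is the converse relation. Further conditions: (NS) $a\,\overline{\mathcal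 C}\,a\Rightarrow a\le\bot$. (SFN) $\forall a\exists b(a\,\overline{\mathcal C}\,b\ \&\ \top\le a\vee b)$. (ALT)$^\rhd$ $a\,\overline{\mathcal C}\,b\Rightarrow\exists c\exists d(\top\le c\vee d\ \&\ a\,\overline{\mathcal C}\,c\ \&\ b\,\overline{\mathcal C}\,d)$. (ALT)$^{\blacktriangleright}$ $b\,\overline{\mathcal C}\,a\Rightarrow\exists c\exists d(\top\le c\vee d\ \&\ c\,\overline{\mathcal C}\,a\ \&\ d\,\overline{\mathcal C}\,b)$. (CMO) $a\,\overline{\mathcal C}\,b\ \&\ a\,\overline{\mathcal C}\,c\Rightarrow(a\wedge c)\,\overline{\mathcal C}\,b$. ($\vee\wedge$) $(a\vee y)\,\overline{\mathcal C}\,x\ \&\ a\,\overline{\mathcal C}\,(x\wedge y)\Rightarrow(a\wedge x)\,\overline{\mathcal C}\,y$. -}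

module Defs where

open import Algebra.Core using (Op₂)
open import Data.Product.Base using (Σ; ∃; ∃₂; _×_; _,_; proj₁; proj₂)
open import Function.Base using (flip)
open import Level using (Level; suc; _⊔_)
open import Relation.Binary.Bundles using (Poset)
open import Relation.Binary.Core using (Rel)
open import Relation.Binary.Definitions using (Maximum; _Respects₂_)
open import Relation.Binary.Lattice.Bundles using (Lattice)
open import Relation.Binary.Lattice.Definitions using (Exponential)
open import Relation.Binary.Lattice.Structures
  using (IsBoundedJoinSemilattice; IsHeytingAlgebra)
open import Relation.Binary.Morphism.Structures using (IsOrderMonomorphism)
open import Relation.Nullary using (¬_)
open import Relation.Unary using (Pred; _∈_; _⊆_; Satisfiable)

UpDirected : ∀ {a ℓ p} {A : Set a} → Rel A ℓ → Pred A p → Set _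
UpDirected _≤_ S =
  ∀ {x y} → x ∈ S → y ∈ S → ∃ λ z → z ∈ S × x ≤ z × y ≤ z

DownDirected : ∀ {a ℓ p} {A : Set a} → Rel A ℓ → Pred A p → Set _
DownDirected _≤_ = UpDirected (flip _≤_)

IsLub : ∀ {a ℓ p} {A : Set a} → Rel A ℓ → Pred A p → A → Set _
IsLub _≤_ S u = (∀ {x} → x ∈ S → x ≤ u) × (∀ {v} → (∀ {x} → x ∈ S → x ≤ v) → u ≤ v)

IsGlb : ∀ {a ℓ p} {A : Set a} → Rel A ℓ → Pred A p → A → Set _
IsGlb _≤_ = IsLub (flip _≤_)

-- The binary operations of the lattice are determined by ⋁ and ⋀ up to _≈_;
-- they are kept as fields only to reuse the library's lattices.
record CompleteLattice (c : Level) : Set (suc c) where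
  field
    lattice : Lattice c c c
  open Lattice lattice public
  field
    ⋁ ⋀   : Pred Carrier c → Carrier
    ⋁-lub : ∀ S → IsLub _≤_ S (⋁ S)
    ⋀-glb : ∀ S → IsGlb _≤_ S (⋀ S)

-- The lattice lives one universe above A because its subset of closed elements
-- is defined by quantifying over the subsets of A.
record CanonicalExtension {ℓ} (A : Poset ℓ ℓ ℓ) : Set (suc (suc ℓ)) where
  open Poset A
  field
    completeLattice : CompleteLattice (suc ℓ)

  open CompleteLattice completeLattice public
    using (⋁; ⋀; ⋁-lub; ⋀-glb)
    renaming (Carrier to Aδ; lattice to latticeδ; _≈_ to _≈δ_; _≤_ to _≤δ_;
              _∨_ to _∨δ_; _∧_ to _∧δ_)

  field
    e             : Carrier → Aδ
    e-isEmbedding : IsOrderMonomorphism _≈_ _≈δ_ _≤_ _≤δ_ e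

  image : Pred Carrier ℓ → Pred Aδ (suc ℓ)
  image S u = ∃ λ a → a ∈ S × u ≈δ e a

  Closed : Pred Aδ (suc ℓ)
  Closed k = Σ (Pred Carrier ℓ) λ F →
    Satisfiable F × DownDirected _≤_ F × k ≈δ ⋀ (image F)

  Open : Pred Aδ (suc ℓ)
  Open o = Σ (Pred Carrier ℓ) λ I →
    Satisfiable I × UpDirected _≤_ I × o ≈δ ⋁ (image I)

  field
    dense-closed : ∀ u → ∃ λ (S : Pred Aδ (suc ℓ)) → S ⊆ Closed × u ≈δ ⋁ S
    dense-open   : ∀ u → ∃ λ (S : Pred Aδ (suc ℓ)) → S ⊆ Open × u ≈δ ⋀ S
    compact      : ∀ (F I : Pred Carrier ℓ) →
                   Satisfiable F → DownDirected _≤_ F →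
                   Satisfiable I → UpDirected _≤_ I →
                   ⋀ (image F) ≤δ ⋁ (image I) →
                   ∃₂ λ a b → a ∈ F × b ∈ I × a ≤ b

  infixr 5 _⟶_

  -- If some largest w with u ∧ w ≤ v exists, it is this join; ⟶-exponential
  -- below shows that it does exist when A is a Heyting algebra.
  _⟶_ : Op₂ Aδ
  u ⟶ v = ⋁ λ w → (u ∧δ w) ≤δ v

  _^κ : (Carrier → Aδ) → Aδ → Aδ
  (f ^κ) k = ⋁ λ w → ∃ λ a → k ≤δ e a × w ≈δ f a

  -- f ^κ is only ever applied to closed elements here.
  _^π : (Carrier → Aδ) → Aδ → Aδ
  (f ^π) u = ⋀ λ w → ∃ λ k → k ∈ Closed × k ≤δ u × w ≈δ (f ^κ) k

record ProtoPrecontactAlgebra ℓ : Set (suc ℓ) where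
  field
    poset : Poset ℓ ℓ ℓ
  open Poset poset public
  field
    C        : Rel Carrier ℓ
    C-resp-≈ : C Respects₂ _≈_

  infix 4 _C̄_
  _C̄_ : Rel Carrier ℓ
  a C̄ b = ¬ (C a b)

module _ {ℓ} (ℂ : ProtoPrecontactAlgebra ℓ) where
  open ProtoPrecontactAlgebra ℂ

  record IsAntitone : Set ℓ where
    field
      SB▷ : ∀ a → ∃ λ b → b C̄ a
      SF▷ : ∀ a → ∃ λ b → a C̄ b
      SI▷ : ∀ {a b c} → b C̄ c → a ≤ b → a C̄ c
      WO▷ : ∀ {a b c} → a C̄ c → b ≤ c → a C̄ b
      DD▷ : ∀ {a x₁ x₂} → a C̄ x₁ → a C̄ x₂ → ∃ λ x → x₁ ≤ x × x₂ ≤ x × a C̄ x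
      UD▷ : ∀ {a₁ a₂ x} → a₁ C̄ x → a₂ C̄ x → ∃ λ a → a₁ ≤ a × a₂ ≤ a × a C̄ x

  record IsPrecontact : Set ℓ where
    infixr 6 _∨_
    field
      isAntitone               : IsAntitone
      _∨_                      : Op₂ Carrier
      ⊥ ⊤                      : Carrier
      isBoundedJoinSemilattice : IsBoundedJoinSemilattice _≈_ _≤_ _∨_ ⊥
      maximum                  : Maximum _≤_ ⊤
      ⊥C̄⊤                      : ⊥ C̄ ⊤
      ⊤C̄⊥                      : ⊤ C̄ ⊥
      AND▷                     : ∀ {a b c} → a C̄ b → a C̄ c → a C̄ (b ∨ c)
      OR▷                      : ∀ {a b c} → a C̄ c → b C̄ c → (a ∨ b) C̄ c

  NS : (⊥ : Carrier) → Set ℓ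
  NS ⊥ = ∀ a → a C̄ a → a ≤ ⊥

  SFN : (_∨_ : Op₂ Carrier) (⊤ : Carrier) → Set ℓ
  SFN _∨_ ⊤ = ∀ a → ∃ λ b → a C̄ b × ⊤ ≤ (a ∨ b)

  ALT▷ : (_∨_ : Op₂ Carrier) (⊤ : Carrier) → Set ℓ
  ALT▷ _∨_ ⊤ = ∀ a b → a C̄ b → ∃₂ λ c d → ⊤ ≤ (c ∨ d) × a C̄ c × b C̄ d

  ALT▶ : (_∨_ : Op₂ Carrier) (⊤ : Carrier) → Set ℓ
  ALT▶ _∨_ ⊤ = ∀ a b → b C̄ a → ∃₂ λ c d → ⊤ ≤ (c ∨ d) × c C̄ a × d C̄ b

  CMO : (_∧_ : Op₂ Carrier) → Set ℓ
  CMO _∧_ = ∀ a b c → a C̄ b → a C̄ c → (a ∧ c) C̄ b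

  ∨∧-condition : (_∨_ _∧_ : Op₂ Carrier) → Set ℓ
  ∨∧-condition _∨_ _∧_ =
    ∀ a x y → (a ∨ y) C̄ x → a C̄ (x ∧ y) → (a ∧ x) C̄ y

module Operators {ℓ} (ℂ : ProtoPrecontactAlgebra ℓ)
                 (E : CanonicalExtension (ProtoPrecontactAlgebra.poset ℂ)) where
  open ProtoPrecontactAlgebra ℂ
  open CanonicalExtension E

  ▷ ▶ : Carrier → Aδ
  ▷ a = ⋁ (image λ b → a C̄ b)
  ▶ a = ⋁ (image λ b → b C̄ a)

  ▷π ▶π : Aδ → Aδ
  ▷π = ▷ ^π
  ▶π = ▶ ^π

module HeytingExtension
  {ℓ} {A : Poset ℓ ℓ ℓ} (E : CanonicalExtension A) where
  open Poset A
  open CanonicalExtension E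
  private
    module D = Lattice latticeδ
    module e = IsOrderMonomorphism e-isEmbedding

  ⟶-exponential : ∀ {_∨_ _∧_ _⇨_ ⊤ ⊥} →
                  IsHeytingAlgebra _≈_ _≤_ _∨_ _∧_ _⇨_ ⊤ ⊥ →
                  Exponential _≤δ_ _∧δ_ _⟶_
  ⟶-exponential {_∧_ = _∧_} {_⇨_ = _⇨_} H w x y =
      (λ w∧x≤y → proj₁ (⋁-lub _)
        (D.trans (D.∧-greatest (D.x∧y≤y x w) (D.x∧y≤x x w)) w∧x≤y))
    , (λ w≤x⟶y → D.trans
        (D.∧-greatest (D.trans (D.x∧y≤x w x) w≤x⟶y) (D.x∧y≤y w x))
        modusPonens)
    where
    open IsHeytingAlgebra H using (x∧y≤x; x∧y≤y; ∧-greatest; transpose-⇨; transpose-∧)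

    below : ∀ {S a} → a ∈ S → ⋀ (image S) ≤δ e a
    below a∈S = proj₁ (⋀-glb _) (_ , a∈S , D.Eq.refl)

    above : ∀ {S a} → a ∈ S → e a ≤δ ⋁ (image S)
    above a∈S = proj₁ (⋁-lub _) (_ , a∈S , D.Eq.refl)

    ≤-by-closed : ∀ {u v} → (∀ {k} → k ∈ Closed → k ≤δ u → k ≤δ v) → u ≤δ v
    ≤-by-closed {u} h with dense-closed u
    ... | S , S⊆Closed , u≈⋁S = D.trans (D.reflexive u≈⋁S)
      (proj₂ (⋁-lub S) λ k∈S → h (S⊆Closed k∈S)
        (D.trans (proj₁ (⋁-lub S) k∈S) (D.reflexive (D.Eq.sym u≈⋁S))))

    ≤-by-open : ∀ {u v} → (∀ {o} → o ∈ Open → v ≤δ o → u ≤δ o) → u ≤δ v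
    ≤-by-open {_} {v} h with dense-open v
    ... | S , S⊆Open , v≈⋀S = D.trans
      (proj₂ (⋀-glb S) λ o∈S → h (S⊆Open o∈S)
        (D.trans (D.reflexive v≈⋀S) (proj₁ (⋀-glb S) o∈S)))
      (D.reflexive (D.Eq.sym v≈⋀S))

    module _ {l o} (l∈K : l ∈ Closed) (o∈O : o ∈ Open)
             (l≤x : l ≤δ x) (y≤o : y ≤δ o) where
      F = proj₁ l∈K
      F-dir : DownDirected _≤_ F
      F-dir = proj₁ (proj₂ (proj₂ l∈K))
      l≈⋀F = proj₂ (proj₂ (proj₂ l∈K))
      I = proj₁ o∈O
      I-dir : UpDirected _≤_ I
      I-dir = proj₁ (proj₂ (proj₂ o∈O))
      o≈⋁I = proj₂ (proj₂ (proj₂ o∈O))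

      J : Pred Carrier ℓ
      J g = ∃₂ λ f b → f ∈ F × b ∈ I × g ≤ (f ⇨ b)

      J-nonempty : Satisfiable J
      J-nonempty with proj₁ (proj₂ l∈K) | proj₁ (proj₂ o∈O)
      ... | f , f∈F | b , b∈I = (f ⇨ b) , f , b , f∈F , b∈I , refl

      J-dir : UpDirected _≤_ J
      J-dir (f , b , f∈F , b∈I , g≤) (f′ , b′ , f′∈F , b′∈I , g′≤)
        with F-dir f∈F f′∈F | I-dir b∈I b′∈I
      ... | f″ , f″∈F , f″≤f , f″≤f′ | b″ , b″∈I , b≤b″ , b′≤b″ =
        (f″ ⇨ b″) , (f″ , b″ , f″∈F , b″∈I , refl)
        , mono g≤ f″≤f b≤b″ , mono g′≤ f″≤f′ b′≤b″
        where
        mono : ∀ {g p q p′ q′} → g ≤ (p ⇨ q) → p′ ≤ p → q ≤ q′ → g ≤ (p′ ⇨ q′)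
        mono g≤ p′≤p q≤q′ = transpose-⇨ (trans
          (∧-greatest (x∧y≤x _ _) (trans (x∧y≤y _ _) p′≤p))
          (trans (transpose-∧ g≤) q≤q′))

      ⟶≤⋁J : (x ⟶ y) ≤δ ⋁ (image J)
      ⟶≤⋁J = proj₂ (⋁-lub _) λ {v} x∧v≤y →
        ≤-by-closed λ { {k} (G , (g₀ , g₀∈G) , G-dir , k≈⋀G) k≤v →
          let f₀ , f₀∈F = proj₁ (proj₂ l∈K)
              M : Pred Carrier ℓ
              M h = ∃₂ λ f g → f ∈ F × g ∈ G × (f ∧ g) ≤ h
              M-dir : DownDirected _≤_ M
              M-dir = λ { (f , g , f∈F , g∈G , ≤h) (f′ , g′ , f′∈F , g′∈G , ≤h′) →
                let f″ , f″∈F , f″≤f , f″≤f′ = F-dir f∈F f′∈F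
                    g″ , g″∈G , g″≤g , g″≤g′ = G-dir g∈G g′∈G
                in (f″ ∧ g″) , (f″ , g″ , f″∈F , g″∈G , refl)
                 , trans (∧-greatest (trans (x∧y≤x _ _) f″≤f) (trans (x∧y≤y _ _) g″≤g)) ≤h
                 , trans (∧-greatest (trans (x∧y≤x _ _) f″≤f′) (trans (x∧y≤y _ _) g″≤g′)) ≤h′ }
              ⋀M≤l : ⋀ (image M) ≤δ l
              ⋀M≤l = D.trans
                (proj₂ (⋀-glb (image F)) λ { (f , f∈F , u≈) →
                  D.trans (below (f , g₀ , f∈F , g₀∈G , x∧y≤x _ _))
                          (D.reflexive (D.Eq.sym u≈)) })
                (D.reflexive (D.Eq.sym l≈⋀F))
              ⋀M≤k : ⋀ (image M) ≤δ k
              ⋀M≤k = D.trans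
                (proj₂ (⋀-glb (image G)) λ { (g , g∈G , u≈) →
                  D.trans (below (f₀ , g , f₀∈F , g∈G , x∧y≤y _ _))
                          (D.reflexive (D.Eq.sym u≈)) })
                (D.reflexive (D.Eq.sym k≈⋀G))
              h , b , (f , g , f∈F , g∈G , f∧g≤h) , b∈I , h≤b =
                compact M I (_ , f₀ , g₀ , f₀∈F , g₀∈G , refl) M-dir
                  (proj₁ (proj₂ o∈O)) I-dir
                  (D.trans (D.∧-greatest (D.trans ⋀M≤l l≤x) (D.trans ⋀M≤k k≤v))
                    (D.trans x∧v≤y (D.trans y≤o (D.reflexive o≈⋁I))))
              g≤f⇨b = transpose-⇨
                (trans (∧-greatest (x∧y≤y _ _) (x∧y≤x _ _)) (trans f∧g≤h h≤b))
          in D.trans (D.reflexive k≈⋀G)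
               (D.trans (below g∈G) (above (f , b , f∈F , b∈I , g≤f⇨b))) }

      l≤⟶⇒l≤o : l ≤δ (x ⟶ y) → l ≤δ o
      l≤⟶⇒l≤o l≤⟶
        with compact F J (proj₁ (proj₂ l∈K)) F-dir J-nonempty J-dir
               (D.trans (D.reflexive (D.Eq.sym l≈⋀F)) (D.trans l≤⟶ ⟶≤⋁J))
      ... | f₁ , j , f₁∈F , (f , b , f∈F , b∈I , j≤f⇨b) , f₁≤j
        with F-dir f₁∈F f∈F
      ... | f₂ , f₂∈F , f₂≤f₁ , f₂≤f =
        D.trans (D.reflexive l≈⋀F)
          (D.trans (below f₂∈F)
            (D.trans (e.mono f₂≤b)
              (D.trans (above b∈I) (D.reflexive (D.Eq.sym o≈⋁I)))))
        where
        f₂≤b = trans (∧-greatest refl f₂≤f)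
                 (transpose-∧ (trans f₂≤f₁ (trans f₁≤j j≤f⇨b)))

    modusPonens : ((x ⟶ y) ∧δ x) ≤δ y
    modusPonens = ≤-by-open λ o∈O y≤o → ≤-by-closed λ l∈K l≤ →
      l≤⟶⇒l≤o l∈K o∈O (D.trans l≤ (D.x∧y≤y _ _)) y≤o (D.trans l≤ (D.x∧y≤x _ _))

{-# OPTIONS --safe #-}

-- Sahlqvist-style correspondence by compactness.  For an ideal I of A and a closed
-- k, k ≤ ⋁ I holds iff k lies below some element of I.  Antitonicity makes the sets
-- defining ▷ a and ▶ a ideals, so for antitone f the value f^π (⋁ I) is the meet
-- of the f b with b ∈ I, and every inequality becomes a first-order condition on C̄.
-- With □ R a = ⋁ {b ∣ R a b}, the operators ▷ and ▶ are □ C̄ and □ (flip C̄).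
module Submission where

open import Defs
open import Data.Product.Base using (_×_; _,_; proj₁; proj₂; ∃; ∃₂)
open import Function.Base using (flip)
open import Function.Bundles using (_⇔_; mk⇔; module Equivalence)
import Function.Properties.Equivalence as ⇔
open import Relation.Binary.Bundles using (Poset)
open import Relation.Binary.Core using (Rel; _⇒_)
open import Relation.Binary.Construct.Composition using () renaming (_;_ to _⨾_)
open import Relation.Binary.Definitions using (Minimum; Maximum)
open import Relation.Binary.Lattice.Bundles using (Lattice; DistributiveLattice)
import Relation.Binary.Lattice.Properties.DistributiveLattice as DistributiveLatticeProperties
open import Relation.Binary.Lattice.Structures using (IsBoundedJoinSemilattice; IsJoinSemilattice; IsMeetSemilattice; IsLattice; IsDistributiveLattice; IsHeytingAlgebra)
open import Relation.Binary.Morphism.Structures using (IsOrderMonomorphism)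
open import Relation.Unary using (Pred; _∈_; Satisfiable)

open Equivalence using (to; from)

⇒flip⇔flip⇒ : ∀ {a r s} {A : Set a} (R : Rel A r) (S : Rel A s) →
              (R ⇒ flip S) ⇔ (flip R ⇒ S)
⇒flip⇔flip⇒ R S = mk⇔ (λ h {_} {_} p → h p) (λ h {_} {_} p → h p)

-- Ideals and relations with ideal sections

module _ {ℓ} (A : Poset ℓ ℓ ℓ) where
  open Poset A

  record IsIdeal (I : Pred Carrier ℓ) : Set ℓ where
    field
      nonempty   : Satisfiable I
      directed   : UpDirected _≤_ I
      downClosed : ∀ {x y} → x ≤ y → y ∈ I → x ∈ I

  principal-isIdeal : ∀ a → IsIdeal (_≤ a)
  principal-isIdeal a = record
    { nonempty   = a , refl
    ; directed   = λ x≤a y≤a → a , refl , x≤a , y≤a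
    ; downClosed = trans
    }

  -- The antitonicity conditions, arranged so that they are symmetric under `flip`.
  record IsIdealRelation (R : Rel Carrier ℓ) : Set ℓ where
    field
      section-isIdeal  : ∀ a → IsIdeal (R a)
      preimage-isIdeal : ∀ a → IsIdeal (flip R a)

    downClosed₂ : ∀ {a b b′} → b′ ≤ b → R a b → R a b′
    downClosed₂ = IsIdeal.downClosed (section-isIdeal _)

    downClosed₁ : ∀ {a a′ b} → a′ ≤ a → R a b → R a′ b
    downClosed₁ = IsIdeal.downClosed (preimage-isIdeal _)

  -- Transfers every result about `▷` to `▶`.
  flip-isIdealRelation : ∀ {R} → IsIdealRelation R → IsIdealRelation (flip R)
  flip-isIdealRelation RI = record
    { section-isIdeal  = preimage-isIdeal
    ; preimage-isIdeal = section-isIdeal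
    }
    where open IsIdealRelation RI

  module _ {R : Rel Carrier ℓ} (RI : IsIdealRelation R) where
    open IsIdealRelation RI

    -- From `R a b`, nonemptiness gives `c` with `R b c`. Then `a ≤ b ≤ c`, so `R b a` by downward
    -- closure, whence `b ≤ a`. The converse is dual.
    ⇒≤⇔⇒≥ : (R ⇒ _≤_) ⇔ (R ⇒ flip _≤_)
    ⇒≤⇔⇒≥ = mk⇔ ≤⇒≥ ≥⇒≤
      where
      ≤⇒≥ : (R ⇒ _≤_) → (R ⇒ flip _≤_)
      ≤⇒≥ h {_} {b} aRb with IsIdeal.nonempty (section-isIdeal b)
      ... | c , bRc = h (downClosed₂ (trans (h aRb) (h bRc)) bRc)

      ≥⇒≤ : (R ⇒ flip _≤_) → (R ⇒ _≤_)
      ≥⇒≤ h {a} aRb with IsIdeal.nonempty (preimage-isIdeal a)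
      ... | c , cRa = h (downClosed₁ (trans (h aRb) (h cRa)) cRa)

    ≤⇒⇔reflexive : (_≤_ ⇒ R) ⇔ (∀ a → R a a)
    ≤⇒⇔reflexive = mk⇔ (λ h a → h refl) (λ h {_} {_} a≤b → downClosed₁ a≤b (h _))

-- Denseness and compactness with ideals

module ExtensionProperties
  {ℓ} {A : Poset ℓ ℓ ℓ} (E : CanonicalExtension A) where
  open Poset A
  open CanonicalExtension E
  private
    module D = Lattice latticeδ
    module e = IsOrderMonomorphism e-isEmbedding

  private variable
    I J : Pred Carrier ℓ
    R S T : Rel Carrier ℓ

  below : ∀ {a} → a ∈ I → ⋀ (image I) ≤δ e a
  below a∈I = proj₁ (⋀-glb _) (_ , a∈I , D.Eq.refl)

  above : ∀ {a} → a ∈ I → e a ≤δ ⋁ (image I)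
  above a∈I = proj₁ (⋁-lub _) (_ , a∈I , D.Eq.refl)

  ⋁-image-least : ∀ {v} → (∀ {a} → a ∈ I → e a ≤δ v) → ⋁ (image I) ≤δ v
  ⋁-image-least h = proj₂ (⋁-lub _)
    λ { (_ , a∈I , u≈) → D.trans (D.reflexive u≈) (h a∈I) }

  ⋀-image-greatest : ∀ {v} → (∀ {a} → a ∈ I → v ≤δ e a) → v ≤δ ⋀ (image I)
  ⋀-image-greatest h = proj₂ (⋀-glb _)
    λ { (_ , a∈I , u≈) → D.trans (h a∈I) (D.reflexive (D.Eq.sym u≈)) }

  ≤-by-closed : ∀ {u v} → (∀ {k} → k ∈ Closed → k ≤δ u → k ≤δ v) → u ≤δ v
  ≤-by-closed {u} h with dense-closed u
  ... | S , S⊆Closed , u≈⋁S = D.trans (D.reflexive u≈⋁S)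
    (proj₂ (⋁-lub S) λ k∈S → h (S⊆Closed k∈S)
      (D.trans (proj₁ (⋁-lub S) k∈S) (D.reflexive (D.Eq.sym u≈⋁S))))

  ≤-by-open : ∀ {u v} → (∀ {o} → o ∈ Open → v ≤δ o → u ≤δ o) → u ≤δ v
  ≤-by-open {_} {v} h with dense-open v
  ... | S , S⊆Open , v≈⋀S = D.trans
    (proj₂ (⋀-glb S) λ o∈S → h (S⊆Open o∈S)
      (D.trans (D.reflexive v≈⋀S) (proj₁ (⋀-glb S) o∈S)))
    (D.reflexive (D.Eq.sym v≈⋀S))

  ⋀-image-closed : Satisfiable I → DownDirected _≤_ I → ⋀ (image I) ∈ Closed
  ⋀-image-closed ne dir = _ , ne , dir , D.Eq.refl

  -- The base is the principal up-set of `a`, so whatever `closed-compact` finds in it lies above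
  -- `a`.
  e-closed : ∀ a → e a ∈ Closed
  e-closed a = (a ≤_) , (a , refl) , (λ a≤x a≤y → a , refl , a≤x , a≤y)
    , D.antisym (⋀-image-greatest e.mono) (below refl)

  -- Puts a bound by `e a` into the form of a join of an ideal, to which `closed-compact` applies.
  e≤⋁↓ : ∀ {a} → e a ≤δ ⋁ (image (_≤ a))
  e≤⋁↓ = above refl

  filterbase : ∀ {k} → k ∈ Closed → Pred Carrier ℓ
  filterbase = proj₁

  closed≤e : ∀ {k} (k∈K : k ∈ Closed) {f} → f ∈ filterbase k∈K → k ≤δ e f
  closed≤e (_ , _ , _ , k≈⋀F) f∈F = D.trans (D.reflexive k≈⋀F) (below f∈F)

  -- Compactness gives `f ≤ b` with `b` in `I`; as `I` is closed downwards, `f` itself lies in `I`.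
  closed-compact : ∀ {k} (k∈K : k ∈ Closed) → IsIdeal A I → k ≤δ ⋁ (image I) →
                   ∃ λ f → f ∈ filterbase k∈K × f ∈ I
  closed-compact (F , F-ne , F-dir , k≈⋀F) II k≤
    with compact F _ F-ne F-dir nonempty directed
           (D.trans (D.reflexive (D.Eq.sym k≈⋀F)) k≤)
    where open IsIdeal II
  ... | f , b , f∈F , b∈I , f≤b = f , f∈F , IsIdeal.downClosed II f≤b b∈I

  -- The two elements found separately have a common lower bound in the filter base, and it stays in
  -- both ideals.
  closed-compact₂ : ∀ {k} (k∈K : k ∈ Closed) → IsIdeal A I → IsIdeal A J →
                    k ≤δ ⋁ (image I) → k ≤δ ⋁ (image J) →
                    ∃ λ f → f ∈ filterbase k∈K × f ∈ I × f ∈ J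
  closed-compact₂ k∈K@(_ , _ , F-dir , _) II JI k≤I k≤J
    with closed-compact k∈K II k≤I | closed-compact k∈K JI k≤J
  ... | f , f∈F , f∈I | g , g∈F , g∈J with F-dir f∈F g∈F
  ... | h , h∈F , h≤f , h≤g =
    h , h∈F , IsIdeal.downClosed II h≤f f∈I , IsIdeal.downClosed JI h≤g g∈J

  e≤⋁⇔∈ : IsIdeal A I → ∀ {a} → e a ≤δ ⋁ (image I) ⇔ a ∈ I
  e≤⋁⇔∈ {I} II {a} = mk⇔ e≤⇒∈ above
    where
    e≤⇒∈ : e a ≤δ ⋁ (image I) → a ∈ I
    e≤⇒∈ ea≤ with closed-compact (e-closed a) II ea≤
    ... | f , a≤f , f∈I = IsIdeal.downClosed II a≤f f∈I

  module _ {_∨_} (isJoin : IsJoinSemilattice _≈_ _≤_ _∨_) where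
    open IsJoinSemilattice isJoin using (x≤x∨y; y≤x∨y; ∨-least)

    ∨-mono : ∀ {a b c d} → a ≤ b → c ≤ d → (a ∨ c) ≤ (b ∨ d)
    ∨-mono a≤b c≤d = ∨-least (trans a≤b (x≤x∨y _ _)) (trans c≤d (y≤x∨y _ _))

    -- An open `o` above `e a` and `e b` is a directed join. Compactness puts `a` and `b` below
    -- members of it, and a common upper bound of these dominates `a ∨ b`.
    e-∨ : ∀ a b → e (a ∨ b) ≤δ (e a ∨δ e b)
    e-∨ a b = ≤-by-open λ { o∈O@(I , I-ne , I-dir , o≈⋁I) ea∨eb≤o →
      let ea≤ = D.trans (D.trans (D.x≤x∨y _ _) ea∨eb≤o) (D.reflexive o≈⋁I)
          eb≤ = D.trans (D.trans (D.y≤x∨y _ _) ea∨eb≤o) (D.reflexive o≈⋁I)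
          i , i∈I , a≤i = upper o∈O ea≤
          j , j∈I , b≤j = upper o∈O eb≤
          l , l∈I , i≤l , j≤l = I-dir i∈I j∈I
      in D.trans (e.mono (∨-least (trans a≤i i≤l) (trans b≤j j≤l)))
           (D.trans (above l∈I) (D.reflexive (D.Eq.sym o≈⋁I))) }
      where
      upper : ∀ {o a} (o∈O : o ∈ Open) → e a ≤δ ⋁ (image (proj₁ o∈O)) →
              ∃ λ b → b ∈ proj₁ o∈O × a ≤ b
      upper {a = a} (I , I-ne , I-dir , _) ea≤
        with compact (a ≤_) I (a , refl) (λ a≤x a≤y → a , refl , a≤x , a≤y)
               I-ne I-dir (D.trans (below refl) ea≤)
      ... | x , b , a≤x , b∈I , x≤b = b , b∈I , trans a≤x x≤b

    -- The elements below some `c ∨ d` form an ideal whose join dominates both given joins, so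
    -- `e≤⋁⇔∈` applies to it.
    ∨-compact : IsIdeal A I → IsIdeal A J → ∀ {t} →
                e t ≤δ (⋁ (image I) ∨δ ⋁ (image J)) →
                ∃₂ λ c d → c ∈ I × d ∈ J × t ≤ (c ∨ d)
    ∨-compact {I} {J} II JI et≤ = to (e≤⋁⇔∈ join-isIdeal) (D.trans et≤ ∨≤join)
      where
      module I = IsIdeal II
      module J = IsIdeal JI

      join : Pred Carrier ℓ
      join x = ∃₂ λ c d → c ∈ I × d ∈ J × x ≤ (c ∨ d)

      join-isIdeal : IsIdeal A join
      join-isIdeal = record
        { nonempty   =
            let c , c∈I = I.nonempty
                d , d∈J = J.nonempty
            in (c ∨ d) , c , d , c∈I , d∈J , refl
        ; directed   = λ { (c , d , c∈I , d∈J , x≤) (c′ , d′ , c′∈I , d′∈J , y≤) →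
            let c″ , c″∈I , c≤c″ , c′≤c″ = I.directed c∈I c′∈I
                d″ , d″∈J , d≤d″ , d′≤d″ = J.directed d∈J d′∈J
            in (c″ ∨ d″) , (c″ , d″ , c″∈I , d″∈J , refl)
               , trans x≤ (∨-mono c≤c″ d≤d″) , trans y≤ (∨-mono c′≤c″ d′≤d″) }
        ; downClosed = λ { x≤y (c , d , c∈I , d∈J , y≤) →
            c , d , c∈I , d∈J , trans x≤y y≤ }
        }

      ∨≤join : (⋁ (image I) ∨δ ⋁ (image J)) ≤δ ⋁ (image join)
      ∨≤join = D.∨-least
        (⋁-image-least λ c∈I → let d , d∈J = J.nonempty in
          above (_ , d , c∈I , d∈J , x≤x∨y _ _))
        (⋁-image-least λ d∈J → let c , c∈I = I.nonempty in
          above (c , _ , c∈I , d∈J , y≤x∨y _ _))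

  module _ {_∧_} (isMeet : IsMeetSemilattice _≈_ _≤_ _∧_) where
    open IsMeetSemilattice isMeet using (x∧y≤x; x∧y≤y; ∧-greatest)

    ∧-mono : ∀ {a b c d} → a ≤ b → c ≤ d → (a ∧ c) ≤ (b ∧ d)
    ∧-mono a≤b c≤d = ∧-greatest (trans (x∧y≤x _ _) a≤b) (trans (x∧y≤y _ _) c≤d)

    e-∧ : ∀ a b → (e a ∧δ e b) ≤δ e (a ∧ b)
    e-∧ a b = ≤-by-closed λ k∈K k≤ →
      let f , f∈F , f≤a , f≤b = closed-compact₂ k∈K
            (principal-isIdeal A a) (principal-isIdeal A b)
            (D.trans k≤ (D.trans (D.x∧y≤x _ _) e≤⋁↓))
            (D.trans k≤ (D.trans (D.x∧y≤y _ _) e≤⋁↓))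
      in D.trans (closed≤e k∈K f∈F) (e.mono (∧-greatest f≤a f≤b))

    -- The elements `b ∧ f` with `f` in `F` generate a filter base with meet below `e b ∧δ k`;
    -- compactness is applied to that base.
    ∧-closed-compact : ∀ {b k} (k∈K : k ∈ Closed) → IsIdeal A I →
                       (e b ∧δ k) ≤δ ⋁ (image I) →
                       ∃ λ f → f ∈ filterbase k∈K × (b ∧ f) ∈ I
    ∧-closed-compact {b = b} (F , (f₀ , f₀∈F) , F-dir , k≈⋀F) II b∧k≤
      with closed-compact (⋀-image-closed {I = b∧F} ne dir) II (D.trans ⋀≤b∧k b∧k≤)
      where
      b∧F : Pred Carrier ℓ
      b∧F h = ∃ λ f → f ∈ F × (b ∧ f) ≤ h
      ne : Satisfiable b∧F
      ne = (b ∧ f₀) , f₀ , f₀∈F , refl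
      dir : DownDirected _≤_ b∧F
      dir (f , f∈F , ≤h) (f′ , f′∈F , ≤h′) =
        let f″ , f″∈F , f″≤f , f″≤f′ = F-dir f∈F f′∈F
        in (b ∧ f″) , (f″ , f″∈F , refl)
           , trans (∧-mono refl f″≤f) ≤h , trans (∧-mono refl f″≤f′) ≤h′
      ⋀≤b∧k : ⋀ (image b∧F) ≤δ (e b ∧δ _)
      -- `b∧F` is closed upwards, so it contains `b` and all of `F`.
      ⋀≤b∧k = D.∧-greatest
        (below (f₀ , f₀∈F , x∧y≤x _ _))
        (D.trans (⋀-image-greatest λ f∈F → below (_ , f∈F , x∧y≤y _ _))
          (D.reflexive (D.Eq.sym k≈⋀F)))
    ... | h , (f , f∈F , b∧f≤h) , h∈I = f , f∈F , IsIdeal.downClosed II b∧f≤h h∈I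

  -- The operators `□ R` on elements of `A`

  □ : Rel Carrier ℓ → Carrier → Aδ
  □ R a = ⋁ (image (R a))

  e≤□⇔ : IsIdealRelation A R → ∀ {a b} → e b ≤δ □ R a ⇔ R a b
  e≤□⇔ RI = e≤⋁⇔∈ (IsIdealRelation.section-isIdeal RI _)

  □-antitone : IsIdealRelation A R → ∀ {a b} → a ≤ b → □ R b ≤δ □ R a
  □-antitone RI a≤b =
    ⋁-image-least λ bRc → above (IsIdealRelation.downClosed₁ RI a≤b bRc)

  □≤□⇔ : IsIdealRelation A R → (∀ a → □ S a ≤δ □ R a) ⇔ (S ⇒ R)
  □≤□⇔ RI = mk⇔
    (λ h {a} {_} aSb → to (e≤□⇔ RI) (D.trans (above aSb) (h a)))
    (λ S⇒R a → ⋁-image-least λ aSb → above (S⇒R aSb))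

  □≤e⇔ : (∀ a → □ R a ≤δ e a) ⇔ (R ⇒ flip _≤_)
  □≤e⇔ = mk⇔
    (λ h {a} {_} aRb → e.cancel (D.trans (above aRb) (h a)))
    (λ h a → ⋁-image-least λ aRb → e.mono (h aRb))

  e≤□⇔reflexive : IsIdealRelation A R → (∀ a → e a ≤δ □ R a) ⇔ (∀ a → R a a)
  e≤□⇔reflexive RI = mk⇔ (λ h a → to (e≤□⇔ RI) (h a)) (λ h a → above (h a))

  -- A closed `k` below `e a` and `□ R a` has a base member `f` with `f ≤ a` and `R a f`, hence
  -- `R f f`.
  e∧□≤e⇔ : IsIdealRelation A R → ∀ ⊥ →
           (∀ a → R a a → a ≤ ⊥) ⇔ (∀ a → (e a ∧δ □ R a) ≤δ e ⊥)
  e∧□≤e⇔ RI ⊥ = mk⇔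
    (λ ns a → ≤-by-closed λ k∈K k≤ →
      let f , f∈F , f≤a , aRf = closed-compact₂ k∈K
            (principal-isIdeal A a) (section-isIdeal a)
            (D.trans k≤ (D.trans (D.x∧y≤x _ _) e≤⋁↓))
            (D.trans k≤ (D.x∧y≤y _ _))
      in D.trans (closed≤e k∈K f∈F) (e.mono (ns f (downClosed₁ f≤a aRf))))
    (λ h a aRa → e.cancel (D.trans (D.∧-greatest D.refl (above aRa)) (h a)))
    where open IsIdealRelation RI

  -- Forwards, `e-∨` carries the join into the extension. Backwards, `∨-compact` splits `t` over the
  -- ideals `_≤ a` and `R a`.
  e≤e∨□⇔ : IsIdealRelation A R →
           ∀ {_∨_} → IsJoinSemilattice _≈_ _≤_ _∨_ → ∀ t →
           (∀ a → ∃ λ b → R a b × t ≤ (a ∨ b)) ⇔ (∀ a → e t ≤δ (e a ∨δ □ R a))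
  e≤e∨□⇔ {R} RI {_∨_} isJoin t = mk⇔ sfn⇒ ⇒sfn
    where
    sfn⇒ : (∀ a → ∃ λ b → R a b × t ≤ (a ∨ b)) → ∀ a → e t ≤δ (e a ∨δ □ R a)
    sfn⇒ h a with h a
    ... | b , aRb , t≤a∨b = D.trans (e.mono t≤a∨b) (D.trans (e-∨ isJoin a b)
      (D.∨-least (D.x≤x∨y _ _) (D.trans (above aRb) (D.y≤x∨y _ _))))

    ⇒sfn : (∀ a → e t ≤δ (e a ∨δ □ R a)) → ∀ a → ∃ λ b → R a b × t ≤ (a ∨ b)
    ⇒sfn h a
      with ∨-compact isJoin (principal-isIdeal A a)
             (IsIdealRelation.section-isIdeal RI a)
             (D.trans (h a) (D.∨-least (D.trans e≤⋁↓ (D.x≤x∨y _ _)) (D.y≤x∨y _ _)))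
    ... | c , b , c≤a , aRb , t≤c∨b = b , aRb , trans t≤c∨b (∨-mono isJoin c≤a refl)

  -- The extension f^π

  κ-upper : ∀ {f k a} → k ≤δ e a → f a ≤δ (f ^κ) k
  κ-upper k≤ea = proj₁ (⋁-lub _) (_ , k≤ea , D.Eq.refl)

  π-greatest : ∀ {f u v} →
               (∀ {k} → k ∈ Closed → k ≤δ u → v ≤δ (f ^κ) k) → v ≤δ (f ^π) u
  π-greatest h = proj₂ (⋀-glb _)
    λ { (_ , k∈K , k≤u , w≈) → D.trans (h k∈K k≤u) (D.reflexive (D.Eq.sym w≈)) }

  -- `e b` is one of the closed elements in the meet defining the extension, and antitonicity bounds
  -- its value by `□ R b`.
  □π≤□ : IsIdealRelation A R → ∀ {u b} → e b ≤δ u → (□ R ^π) u ≤δ □ R b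
  □π≤□ RI {b = b} eb≤u = D.trans
    (proj₁ (⋀-glb _) (e b , e-closed b , eb≤u , D.Eq.refl))
    (proj₂ (⋁-lub _) λ { (_ , eb≤ea , w≈) →
      D.trans (D.reflexive w≈) (□-antitone RI (e.cancel eb≤ea)) })

  -- A closed `k` below the join has a base member `f` in `I`, and `k ≤δ e f` makes `□ R f` a lower
  -- bound of the value at `k`.
  ≤□π⋁⇔ : IsIdealRelation A R → IsIdeal A I → ∀ {u} →
          u ≤δ (□ R ^π) (⋁ (image I)) ⇔ (∀ {b} → b ∈ I → u ≤δ □ R b)
  ≤□π⋁⇔ RI II = mk⇔
    (λ u≤ {_} b∈I → D.trans u≤ (□π≤□ RI (above b∈I)))
    (λ h → π-greatest λ k∈K k≤ →
      let f , f∈F , f∈I = closed-compact k∈K II k≤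
      in D.trans (h f∈I) (κ-upper (closed≤e k∈K f∈F)))

  -- Eliminates the inner operator by `≤□π⋁⇔`, then the two outer ones by their defining joins.
  □≤□π□⇔ : IsIdealRelation A R → IsIdealRelation A T →
           (∀ a → □ S a ≤δ (□ R ^π) (□ T a)) ⇔
           (∀ {a b c} → T a b → S a c → R b c)
  □≤□π□⇔ RI TI = mk⇔
    (λ h {a} {_} {_} aTb aSc → to (e≤□⇔ RI) (D.trans (above aSc)
      (to (≤□π⋁⇔ RI (section-isIdeal a)) (h a) aTb)))
    (λ h a → from (≤□π⋁⇔ RI (section-isIdeal a))
      λ aTb → ⋁-image-least λ aSc → above (h aTb aSc))
    where open IsIdealRelation TI

  ⨾⇒⇔□≤□π□ : IsIdealRelation A R → IsIdealRelation A T →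
              ((flip T ⨾ S) ⇒ R) ⇔ (∀ a → □ S a ≤δ (□ R ^π) (□ T a))
  ⨾⇒⇔□≤□π□ RI TI = ⇔.trans
    (mk⇔ (λ h {a} {_} {_} aTb aSc → h (a , aTb , aSc))
         (λ { h {_} {_} (_ , aTb , aSc) → h aTb aSc }))
    (⇔.sym (□≤□π□⇔ RI TI))

  -- The first-order condition is invariant under exchanging `S` and `T` while reversing `R`.
  □≤□π□-swap : IsIdealRelation A R → IsIdealRelation A S → IsIdealRelation A T →
               (∀ a → □ S a ≤δ (□ R ^π) (□ T a)) ⇔
               (∀ a → □ T a ≤δ (□ (flip R) ^π) (□ S a))
  □≤□π□-swap RI SI TI = ⇔.trans (□≤□π□⇔ RI TI) (⇔.trans
    (mk⇔ (λ h {_} {_} {_} aSb aTc → h aTc aSb) (λ h {_} {_} {_} aTb aSc → h aSc aTb))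
    (⇔.sym (□≤□π□⇔ (flip-isIdealRelation A RI) SI)))

  -- The inequality says that `e a ≤δ □ R b` whenever `R a b`, and that bound means `R b a`.
  e≤□π□⇔symmetric : IsIdealRelation A R →
                    (∀ a → e a ≤δ (□ R ^π) (□ R a)) ⇔ (R ⇒ flip R)
  e≤□π□⇔symmetric RI = mk⇔
    (λ h {a} {_} aRb → to (e≤□⇔ RI) (to (≤□π⋁⇔ RI (section-isIdeal a)) (h a) aRb))
    (λ h a → from (≤□π⋁⇔ RI (section-isIdeal a)) λ aRb → above (h aRb))
    where open IsIdealRelation RI

  -- Forwards, a closed `k` below the meet has a base member `f` with `f ≤ a` and `R a f`; the
  -- condition applies to `a ∧ f`, which is above `f`. Backwards, `R a c` puts `e (a ∧ c)` below the
  -- meet.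
  □≤□π[e∧□]⇔ : IsIdealRelation A R →
               ∀ {_∧_} → IsMeetSemilattice _≈_ _≤_ _∧_ →
               (∀ a b c → R a b → R a c → R (a ∧ c) b) ⇔
               (∀ a → □ R a ≤δ (□ R ^π) (e a ∧δ □ R a))
  □≤□π[e∧□]⇔ RI isMeet = mk⇔
    (λ cmo a → π-greatest λ k∈K k≤ →
      let f , f∈F , f≤a , aRf = closed-compact₂ k∈K
            (principal-isIdeal A a) (section-isIdeal a)
            (D.trans k≤ (D.trans (D.x∧y≤x _ _) e≤⋁↓))
            (D.trans k≤ (D.x∧y≤y _ _))
      in D.trans
           (⋁-image-least λ aRb →
             above (downClosed₁ (∧-greatest f≤a refl) (cmo a _ f aRb aRf)))
           (κ-upper (closed≤e k∈K f∈F)))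
    (λ h a b c aRb aRc → to (e≤□⇔ RI) (D.trans (above aRb) (D.trans (h a)
      (□π≤□ RI (D.∧-greatest (e.mono (x∧y≤x a c))
        (D.trans (e.mono (x∧y≤y a c)) (above aRc)))))))
    where
    open IsIdealRelation RI
    open IsMeetSemilattice isMeet using (x∧y≤x; x∧y≤y; ∧-greatest)

  -- Distributive lattices and Heyting algebras

  module _ (RI : IsIdealRelation A R)
           {_∨_ _∧_} (isDistributive : IsDistributiveLattice _≈_ _≤_ _∨_ _∧_)
           {⊤} (maximum : Maximum _≤_ ⊤) where
    open IsIdealRelation RI
    open IsDistributiveLattice isDistributive
      using (isLattice; x≤x∨y; y≤x∨y; x∧y≤x; x∧y≤y; ∨-least; ∧-greatest)
    private
      distributiveLattice : DistributiveLattice ℓ ℓ ℓ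
      distributiveLattice = record { isDistributiveLattice = isDistributive }
      isJoin : IsJoinSemilattice _≈_ _≤_ _∨_
      isJoin = IsLattice.isJoinSemilattice isLattice
    open DistributiveLatticeProperties distributiveLattice using (∨-distribˡ-∧)

    -- By distributivity the elements complementing some member of R a form a filter
    -- base; its meet k is a closed complement of □ R a lying below □π (□ R a).
    ⊤≤□∨□π□⇔ : (∀ a b → R a b → ∃₂ λ c d → ⊤ ≤ (c ∨ d) × R a c × R b d) ⇔
                (∀ a → e ⊤ ≤δ (□ R a ∨δ (□ R ^π) (□ R a)))
    ⊤≤□∨□π□⇔ = mk⇔ alt⇒ ⇒alt
      where
      alt⇒ : (∀ a b → R a b → ∃₂ λ c d → ⊤ ≤ (c ∨ d) × R a c × R b d) →
             ∀ a → e ⊤ ≤δ (□ R a ∨δ (□ R ^π) (□ R a))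
      alt⇒ alt a = D.trans ⊤≤□∨k
        (D.∨-least (D.x≤x∨y _ _) (D.trans k≤□π□ (D.y≤x∨y _ _)))
        where
        open IsIdeal (section-isIdeal a)

        F : Pred Carrier ℓ
        F d = ∃ λ c → R a c × ⊤ ≤ (c ∨ d)

        F-nonempty : Satisfiable F
        F-nonempty = ⊤ , proj₁ nonempty , proj₂ nonempty , y≤x∨y _ _

        F-directed : DownDirected _≤_ F
        F-directed {d} {d′} (c , aRc , ⊤≤c∨d) (c′ , aRc′ , ⊤≤c′∨d′)
          with directed aRc aRc′
        ... | c″ , aRc″ , c≤c″ , c′≤c″ =
          (d ∧ d′) , (c″ , aRc″ , ⊤≤c″∨d∧d′) , x∧y≤x d d′ , x∧y≤y d d′
          where
          ⊤≤c″∨d∧d′ : ⊤ ≤ (c″ ∨ (d ∧ d′))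
          ⊤≤c″∨d∧d′ = trans
            (∧-greatest (trans ⊤≤c∨d (∨-mono isJoin c≤c″ refl))
                        (trans ⊤≤c′∨d′ (∨-mono isJoin c′≤c″ refl)))
            (reflexive (Eq.sym (∨-distribˡ-∧ c″ d d′)))

        -- For each `b` with `R a b`, the hypothesis supplies a member `d` of `F` with `R b d`.
        k≤□π□ : ⋀ (image F) ≤δ (□ R ^π) (□ R a)
        k≤□π□ = from (≤□π⋁⇔ RI (section-isIdeal a)) λ {b} aRb →
          let c , d , ⊤≤c∨d , aRc , bRd = alt a b aRb
          in D.trans (below (c , aRc , ⊤≤c∨d)) (above bRd)

        -- For an open `o` above the join, compactness gives `d ≤ i` with `d` in `F` and `e i ≤δ o`;
        -- the partner `c` of `d` then yields `⊤ ≤ c ∨ i`.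
        ⊤≤□∨k : e ⊤ ≤δ (□ R a ∨δ ⋀ (image F))
        ⊤≤□∨k = ≤-by-open λ { (I , I-ne , I-dir , o≈⋁I) ≤o →
          let d , i , (c , aRc , ⊤≤c∨d) , i∈I , d≤i =
                compact F I F-nonempty F-directed I-ne I-dir
                  (D.trans (D.y≤x∨y _ _) (D.trans ≤o (D.reflexive o≈⋁I)))
              ei≤o = D.trans (above i∈I) (D.reflexive (D.Eq.sym o≈⋁I))
              ec≤o = D.trans (above aRc) (D.trans (D.x≤x∨y _ _) ≤o)
          in D.trans (e.mono (trans ⊤≤c∨d (∨-mono isJoin refl d≤i)))
               (D.trans (e-∨ isJoin c i) (D.∨-least ec≤o ei≤o)) }

      ⇒alt : (∀ a → e ⊤ ≤δ (□ R a ∨δ (□ R ^π) (□ R a))) →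
             ∀ a b → R a b → ∃₂ λ c d → ⊤ ≤ (c ∨ d) × R a c × R b d
      ⇒alt h a b aRb =
        -- `R a b` bounds the second joinand by `□ R b`, leaving a join of two ideals to split.
        let c , d , aRc , bRd , ⊤≤c∨d =
              ∨-compact isJoin (section-isIdeal a) (section-isIdeal b)
                (D.trans (h a) (D.∨-least (D.x≤x∨y _ _)
                  (D.trans (□π≤□ RI (above aRb)) (D.y≤x∨y _ _))))
        in c , d , ⊤≤c∨d , aRc , bRd

  module _ (RI : IsIdealRelation A R)
           {_∨_ _∧_ _⇨_ ⊤ ⊥} (H : IsHeytingAlgebra _≈_ _≤_ _∨_ _∧_ _⇨_ ⊤ ⊥) where
    open IsIdealRelation RI
    open IsHeytingAlgebra H using (isLattice; x∧y≤x; x∧y≤y; ∧-greatest)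
    private
      isMeet : IsMeetSemilattice _≈_ _≤_ _∧_
      isMeet = IsLattice.isMeetSemilattice isLattice

      ⟶-intro : ∀ {u v w} → (w ∧δ u) ≤δ v → w ≤δ (u ⟶ v)
      ⟶-intro = proj₁ (HeytingExtension.⟶-exponential E H _ _ _)

      ⟶-elim : ∀ {u v w} → w ≤δ (u ⟶ v) → (w ∧δ u) ≤δ v
      ⟶-elim = proj₂ (HeytingExtension.⟶-exponential E H _ _ _)

    -- By residuation a closed `k` is tested below `e a` and both conjuncts. Its base has one
    -- `x ≤ a` to which the condition applies with `y = b`, and `x ≤ a ∧ x` turns the result into
    -- `R x b`. Conversely, `e (a ∧ x)` lies below `e a` and both conjuncts.
    □∧⟶≤⟶□⇔ : (∀ a x y → R (a ∨ y) x → R a (x ∧ y) → R (a ∧ x) y) ⇔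
                (∀ a b → (□ R (a ∨ b) ∧δ (e b ⟶ □ R a)) ≤δ (e a ⟶ □ (flip R) b))
    □∧⟶≤⟶□⇔ = mk⇔ cond⇒ ⇒cond
      where
      cond⇒ : (∀ a x y → R (a ∨ y) x → R a (x ∧ y) → R (a ∧ x) y) →
              ∀ a b → (□ R (a ∨ b) ∧δ (e b ⟶ □ R a)) ≤δ (e a ⟶ □ (flip R) b)
      cond⇒ h a b = ⟶-intro (≤-by-closed λ { k∈K@(_ , _ , F-dir , _) k≤ →
        let k≤□∧⟶ = D.trans k≤ (D.x∧y≤x _ _)
            k≤ea   = D.trans k≤ (D.x∧y≤y _ _)
            f , f∈F , a∨bRf , f≤a = closed-compact₂ k∈K
              (section-isIdeal (a ∨ b)) (principal-isIdeal A a)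
              (D.trans k≤□∧⟶ (D.x∧y≤x _ _)) (D.trans k≤ea e≤⋁↓)
            -- Residuation turns `k ≤δ (e b ⟶ □ R a)` into a bound on `e b ∧δ k`.
            g , g∈F , aRb∧g = ∧-closed-compact isMeet k∈K (section-isIdeal a)
              (D.trans (D.∧-greatest (D.x∧y≤y _ _) (D.x∧y≤x _ _))
                (⟶-elim (D.trans k≤□∧⟶ (D.x∧y≤y _ _))))
            x , x∈F , x≤f , x≤g = F-dir f∈F g∈F
            a∧xRb = h a x b (downClosed₂ x≤f a∨bRf)
              (downClosed₂ (∧-greatest (x∧y≤y _ _) (trans (x∧y≤x _ _) x≤g)) aRb∧g)
        in D.trans (closed≤e k∈K x∈F)
             (above (downClosed₁ (∧-greatest (trans x≤f f≤a) refl) a∧xRb)) })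

      ⇒cond : (∀ a b → (□ R (a ∨ b) ∧δ (e b ⟶ □ R a)) ≤δ (e a ⟶ □ (flip R) b)) →
              ∀ a x y → R (a ∨ y) x → R a (x ∧ y) → R (a ∧ x) y
      ⇒cond h a x y a∨yRx aRx∧y = to (e≤□⇔ (flip-isIdealRelation A RI)) (D.trans
        (D.∧-greatest (e.mono (x∧y≤y a x)) (e.mono (x∧y≤x a x)))
        (⟶-elim (D.trans (D.∧-greatest (above a∨yRx) ex≤ey⟶□) (h a y))))
        where
        ex≤ey⟶□ : e x ≤δ (e y ⟶ □ R a)
        ex≤ey⟶□ = ⟶-intro (D.trans (e-∧ isMeet x y) (above aRx∧y))

-- Antitone and precontact algebras

module _ {ℓ} {ℂ : ProtoPrecontactAlgebra ℓ} where
  open ProtoPrecontactAlgebra ℂ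

  antitone⇒idealRelation : IsAntitone ℂ → IsIdealRelation poset _C̄_
  antitone⇒idealRelation antitone = record
    { section-isIdeal  = λ a → record
      { nonempty   = SF▷ a
      ; directed   = λ aC̄x aC̄y →
          let z , x≤z , y≤z , aC̄z = DD▷ aC̄x aC̄y in z , aC̄z , x≤z , y≤z
      ; downClosed = λ b≤c aC̄c → WO▷ aC̄c b≤c
      }
    ; preimage-isIdeal = λ c → record
      { nonempty   = SB▷ c
      ; directed   = λ xC̄c yC̄c →
          let z , x≤z , y≤z , zC̄c = UD▷ xC̄c yC̄c in z , zC̄c , x≤z , y≤z
      ; downClosed = λ a≤b bC̄c → SI▷ bC̄c a≤b
      }
    }
    where open IsAntitone antitone

  module _ (P : IsPrecontact ℂ) where
    open IsPrecontact P
    open IsIdealRelation (antitone⇒idealRelation isAntitone)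

    ⊤C̄⊤⇒total : ⊤ C̄ ⊤ → ∀ a b → a C̄ b
    ⊤C̄⊤⇒total ⊤C̄⊤ a b = downClosed₁ (maximum a) (downClosed₂ (maximum b) ⊤C̄⊤)

    -- In 2 (ii) the inequalities unfold to the left-hand condition and the compositions
    -- to the right-hand one.  They agree because ⊥ C̄ ⊤ and ⊤ C̄ ⊥ make either of them
    -- force C̄ to be total.
    leftEuclidean⇔rightEuclidean :
      (∀ {a b c} → b C̄ a → c C̄ a → c C̄ b) ⇔ (∀ {a b c} → a C̄ b → a C̄ c → b C̄ c)
    leftEuclidean⇔rightEuclidean = mk⇔
      (λ h {_} {b} {c} _ _ → ⊤C̄⊤⇒total (h ⊤C̄⊥ ⊤C̄⊥) b c)
      (λ h {_} {b} {c} _ _ → ⊤C̄⊤⇒total (h ⊥C̄⊤ ⊥C̄⊤) c b)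

proposition5p3 :
  ∀ {ℓ} (ℂ : ProtoPrecontactAlgebra ℓ)
    (E : CanonicalExtension (ProtoPrecontactAlgebra.poset ℂ)) →
  let open ProtoPrecontactAlgebra ℂ
      open CanonicalExtension E
      open Operators ℂ E
  in
    -- 1
    (IsAntitone ℂ →
        ((_C̄_ ⇒ _≤_) ⇔ (∀ a → ▷ a ≤δ e a))
      × ((_≤_ ⇒ _C̄_) ⇔ (∀ a → e a ≤δ ▷ a))
      × ((_C̄_ ⇒ flip _≤_) ⇔ (∀ a → ▶ a ≤δ e a))
      × ((flip _≤_ ⇒ _C̄_) ⇔ (∀ a → e a ≤δ ▶ a))
      × (∀ ⊥ ⊤ → Minimum _≤_ ⊥ → Maximum _≤_ ⊤ →
          NS ℂ ⊥ ⇔ (∀ a → (e a ∧δ ▷ a) ≤δ e ⊥))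
      × (∀ _∨_ ⊥ ⊤ → IsBoundedJoinSemilattice _≈_ _≤_ _∨_ ⊥ → Maximum _≤_ ⊤ →
          SFN ℂ _∨_ ⊤ ⇔ (∀ a → e ⊤ ≤δ (e a ∨δ ▷ a))))
  × ((P : IsPrecontact ℂ) → let open IsPrecontact P in
        -- 2 (i)
        (   (((flip _C̄_ ⨾ _C̄_) ⇒ _C̄_) ⇔ (∀ a → ▷ a ≤δ ▷π (▷ a)))
          × ((∀ a → ▷ a ≤δ ▷π (▷ a)) ⇔ (∀ a → ▷ a ≤δ ▶π (▷ a)))
          × ((∀ a → ▷ a ≤δ ▶π (▷ a)) ⇔ ((flip _C̄_ ⨾ _C̄_) ⇒ flip _C̄_)))
        -- 2 (ii)
      × (   (((flip _C̄_ ⨾ _C̄_) ⇒ _C̄_) ⇔ (∀ a → ▶ a ≤δ ▶π (▶ a)))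
          × ((∀ a → ▶ a ≤δ ▶π (▶ a)) ⇔ (∀ a → ▶ a ≤δ ▷π (▶ a)))
          × ((∀ a → ▶ a ≤δ ▷π (▶ a)) ⇔ ((flip _C̄_ ⨾ _C̄_) ⇒ flip _C̄_)))
        -- 2 (iii)
      × (   (((_C̄_ ⨾ _C̄_) ⇒ _C̄_) ⇔ (∀ a → ▶ a ≤δ ▶π (▷ a)))
          × ((∀ a → ▶ a ≤δ ▶π (▷ a)) ⇔ (∀ a → ▷ a ≤δ ▷π (▶ a)))
          × ((∀ a → ▷ a ≤δ ▷π (▶ a)) ⇔ ((flip _C̄_ ⨾ flip _C̄_) ⇒ flip _C̄_)))
        -- 2 (iv)
      × (   (((_C̄_ ⨾ _C̄_) ⇒ flip _C̄_) ⇔ (∀ a → ▷ a ≤δ ▶π (▶ a)))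
          × ((∀ a → ▷ a ≤δ ▶π (▶ a)) ⇔ (∀ a → ▶ a ≤δ ▷π (▷ a)))
          × ((∀ a → ▶ a ≤δ ▷π (▷ a)) ⇔ ((flip _C̄_ ⨾ flip _C̄_) ⇒ _C̄_)))
        -- 3
      × (∀ _∧_ → IsLattice _≈_ _≤_ _∨_ _∧_ →
            ((_C̄_ ⇒ flip _C̄_) ⇔ (flip _C̄_ ⇒ _C̄_))
          × ((flip _C̄_ ⇒ _C̄_) ⇔ (∀ a → ▷ a ≤δ ▶ a))
          × ((∀ a → ▷ a ≤δ ▶ a) ⇔ (∀ a → e a ≤δ ▷π (▷ a)))
          × ((∀ a → e a ≤δ ▷π (▷ a)) ⇔ (∀ a → ▶ a ≤δ ▷ a))
          × ((∀ a → ▶ a ≤δ ▷ a) ⇔ (∀ a → e a ≤δ ▶π (▶ a))))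
        -- 4
      × (∀ _∧_ → IsMeetSemilattice _≈_ _≤_ _∧_ →
          CMO ℂ _∧_ ⇔ (∀ a → ▷ a ≤δ ▷π (e a ∧δ ▷ a)))
        -- 5
      × (∀ _∧_ → IsDistributiveLattice _≈_ _≤_ _∨_ _∧_ →
            (ALT▷ ℂ _∨_ ⊤ ⇔ (∀ a → e ⊤ ≤δ (▷ a ∨δ ▷π (▷ a))))
          × (ALT▶ ℂ _∨_ ⊤ ⇔ (∀ a → e ⊤ ≤δ (▶ a ∨δ ▶π (▶ a)))))
        -- 6
      × (∀ _∧_ _⇨_ → IsHeytingAlgebra _≈_ _≤_ _∨_ _∧_ _⇨_ ⊤ ⊥ →
          ∨∧-condition ℂ _∨_ _∧_ ⇔
          (∀ a b → (▷ (a ∨ b) ∧δ (e b ⟶ ▷ a)) ≤δ (e a ⟶ ▶ b))))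
proposition5p3 ℂ E =
    (λ antitone →
      let CI  = antitone⇒idealRelation antitone
          CI′ = flip-isIdealRelation poset CI
      -- `▷ a ≤δ e a` unfolds to inclusion in the converse order, which `⇒≤⇔⇒≥` turns around.
      in ⇔.trans (⇒≤⇔⇒≥ poset CI) (⇔.sym □≤e⇔)
       , ⇔.trans (≤⇒⇔reflexive poset CI) (⇔.sym (e≤□⇔reflexive CI))
       , ⇔.trans (⇒flip⇔flip⇒ _C̄_ _≤_)
           (⇔.trans (⇒≤⇔⇒≥ poset CI′) (⇔.sym □≤e⇔))
       , ⇔.trans (⇔.sym (⇒flip⇔flip⇒ _≤_ _C̄_))
           (⇔.trans (≤⇒⇔reflexive poset CI′) (⇔.sym (e≤□⇔reflexive CI′)))
       , (λ ⊥ _ _ _ → e∧□≤e⇔ CI ⊥)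
       , (λ _ _ ⊤ isJoin _ →
           e≤e∨□⇔ CI (IsBoundedJoinSemilattice.isJoinSemilattice isJoin) ⊤))
  , λ P →
      let open IsPrecontact P
          CI  = antitone⇒idealRelation isAntitone
          CI′ = flip-isIdealRelation poset CI
          C̄-flip    = ⇒flip⇔flip⇒ _C̄_ _C̄_
          ▷▷▷⇔▶▶▶ = ⇔.trans (□≤□π□⇔ CI CI)
            (⇔.trans (⇔.sym (leftEuclidean⇔rightEuclidean P))
              (⇔.sym (□≤□π□⇔ CI′ CI′)))
      in ( ⨾⇒⇔□≤□π□ CI CI
         , □≤□π□-swap CI CI CI
         , ⇔.sym (⨾⇒⇔□≤□π□ CI′ CI))
       , ( ⇔.trans (⨾⇒⇔□≤□π□ CI CI) ▷▷▷⇔▶▶▶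
         , □≤□π□-swap CI′ CI′ CI′
         -- The composition inclusion is about `▷`, so the chain crosses back from the left to the
         -- right Euclidean condition.
         , ⇔.trans (□≤□π□-swap CI CI′ CI′)
             (⇔.trans (⇔.sym ▷▷▷⇔▶▶▶)
               (⇔.trans (□≤□π□-swap CI CI CI) (⇔.sym (⨾⇒⇔□≤□π□ CI′ CI)))))
       -- The composition unfolds first to `▷ a ≤δ ▷π (▶ a)`; the swap gives the listed form.
       , ( ⇔.trans (⨾⇒⇔□≤□π□ CI CI′) (□≤□π□-swap CI CI CI′)
         , □≤□π□-swap CI′ CI′ CI
         , ⇔.trans (□≤□π□-swap CI CI CI′) (⇔.sym (⨾⇒⇔□≤□π□ CI′ CI)))
       , ( ⨾⇒⇔□≤□π□ CI′ CI′
         , □≤□π□-swap CI′ CI CI′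
         , ⇔.sym (⨾⇒⇔□≤□π□ CI CI))
       -- Each inequality here unfolds to symmetry of `_C̄_`, in one of the two forms exchanged by
       -- `C̄-flip`.
       , (λ _ _ →
             C̄-flip
           , ⇔.trans (⇔.sym C̄-flip) (⇔.sym (□≤□⇔ CI′))
           , ⇔.trans (□≤□⇔ CI′) (⇔.sym (e≤□π□⇔symmetric CI))
           , ⇔.trans (e≤□π□⇔symmetric CI) (⇔.trans C̄-flip (⇔.sym (□≤□⇔ CI)))
           , ⇔.trans (□≤□⇔ CI) (⇔.sym (e≤□π□⇔symmetric CI′)))
       , (λ _ isMeet → □≤□π[e∧□]⇔ CI isMeet)
       , (λ _ isDistributive → ⊤≤□∨□π□⇔ CI isDistributive maximum
                             , ⊤≤□∨□π□⇔ CI′ isDistributive maximum)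
       , (λ _ _ isHeyting → □∧⟶≤⟶□⇔ CI isHeyting)
  where
  open ProtoPrecontactAlgebra ℂ
  open ExtensionProperties E
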